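{- Let $T$ be a tree. Then $\mathsf{TS}_2(T)$ is acyclic if and only if $T$ is $\{2K_2, D_{2,2,2}\}$-free.
   Context: Graphs are finite, simple and undirected. For a graph $G$ and an integer $k\ge 2$, $\mathsf{TS}_k(G)$ is the graph whose nodes are all size-$k$ independent sets of $G$, two nodes $I,J$ being adjacent if there are vertices $u,v$ of $G$ with $I\setminus J=\{u\}$, $J\setminus I=\{v\}$ and $uv\in E(G)$. (A graph with no nodes counts as acyclic.) $2K_2$ is the disjoint union of two copies of $K_2$. For integers $n,r,s\ge 1$, $D_{r,n,s}$ is the tree obtained from the path $P_n$ on $n$ vertices by attaching $r$ leaves to one end vertex and $s$ leaves to the other end vertex. A graph is $\mathcal{F}$-free if it contains no member of $\mathcal{F}$ as an induced subgraph (up to isomorphism). -}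

module Defs where

open import Data.Empty using (⊥)
open import Data.Fin using (Fin; toℕ; fromℕ)
import Data.Fin as Fin
import Data.Fin.Properties as Finₚ
open import Data.Fin.Subset using (Subset; _∈_; _─_; ⁅_⁆; ∣_∣)
open import Data.Fin.Subset.Properties using (x∈⁅x⁆; x∈⁅y⁆⇒x≡y)
open import Data.List using (List; _∷_; _∷ʳ_; length)
open import Data.List.Relation.Unary.All using (All)
open import Data.List.Relation.Unary.Linked using (Linked)
open import Data.List.Relation.Unary.Unique.Propositional using (Unique)
open import Data.Nat using (ℕ; suc; _≤_; NonZero)
import Data.Nat.Properties as ℕₚ
open import Data.Product using (∃; ∃-syntax; _×_; _,_; proj₂)
open import Data.Refinement using (Refinement-syntax; value)
import Data.Refinement as Refinement
open import Data.Sum using (_⊎_; inj₁; inj₂; swap)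
import Data.Sum.Properties as Sumₚ
open import Data.Vec.Properties using (≡-dec)
import Data.Bool as Bool
open import Function.Bundles using (_⇔_)
open import Function.Definitions using (Injective)
open import Level using (0ℓ)
open import Relation.Binary.Construct.Closure.ReflexiveTransitive using (Star)
open import Relation.Binary.Core using (Rel)
open import Relation.Binary.Definitions
  using (Decidable; DecidableEquality; Symmetric)
open import Relation.Binary.PropositionalEquality
  using (_≡_; _≢_; refl; sym; trans; subst; ≢-sym)
open import Relation.Nullary using (¬_; no)
open import Relation.Nullary.Decidable using (¬?; _×-dec_; _⊎-dec_)

-- Simple undirected graphs.  Decidability of equality and adjacency holds
-- classically for every graph and constructively for every explicitly given
-- finite one.  Finiteness comes from the vertex type: a finite graph of
-- order n is a Graph (Fin n).

record Graph (V : Set) : Set₁ where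
  infix 4 _~_ _~?_ _≟_
  field
    _~_      : Rel V 0ℓ
    ~-sym    : Symmetric _~_
    ~-irrefl : ∀ {v} → ¬ (v ~ v)
    _~?_     : Decidable _~_
    _≟_      : DecidableEquality V

-- v, vs and then v again is a closed walk; at least three distinct vertices
-- are required, so that an edge walked back and forth is not a cycle.

record Cycle {V : Set} (G : Graph V) : Set where
  open Graph G
  field
    v        : V
    vs       : List V
    distinct : Unique (v ∷ vs)
    closed   : Linked _~_ ((v ∷ vs) ∷ʳ v)
    long     : 3 ≤ length (v ∷ vs)

Acyclic : {V : Set} → Graph V → Set
Acyclic G = ¬ Cycle G

Connected : {V : Set} → Graph V → Set
Connected G = ∀ u v → Star (Graph._~_ G) u v

record IsTree {V : Set} (G : Graph V) : Set where
  field
    root      : V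
    connected : Connected G
    acyclic   : Acyclic G

-- H is isomorphic to an induced subgraph of G.

record _≤ᵢ_ {W V : Set} (H : Graph W) (G : Graph V) : Set where
  private
    module H = Graph H
    module G = Graph G
  field
    embed     : W → V
    injective : Injective _≡_ _≡_ embed
    induced   : ∀ u v → (u H.~ v) ⇔ (embed u G.~ embed v)

Free : {V : Set} → List (∃ Graph) → Graph V → Set₁
Free 𝓕 G = All (λ H → ¬ (proj₂ H ≤ᵢ G)) 𝓕

-- Complete graph, path, disjoint union

K : ∀ n → Graph (Fin n)
K n = record
  { _~_      = _≢_
  ; ~-sym    = ≢-sym
  ; ~-irrefl = λ v≢v → v≢v refl
  ; _~?_     = λ u v → ¬? (u Finₚ.≟ v)
  ; _≟_      = Finₚ._≟_
  }

P : ∀ n → Graph (Fin n)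
P n = record
  { _~_      = λ i j → toℕ j ≡ suc (toℕ i) ⊎ toℕ i ≡ suc (toℕ j)
  ; ~-sym    = swap
  ; ~-irrefl = λ where
      (inj₁ e) → ℕₚ.1+n≢n (sym e)
      (inj₂ e) → ℕₚ.1+n≢n (sym e)
  ; _~?_     = λ i j → (toℕ j ℕₚ.≟ suc (toℕ i)) ⊎-dec (toℕ i ℕₚ.≟ suc (toℕ j))
  ; _≟_      = Finₚ._≟_
  }

module _ {V W : Set} (G : Graph V) (H : Graph W) where
  private
    module G = Graph G
    module H = Graph H

    _~_ : Rel (V ⊎ W) 0ℓ
    inj₁ u ~ inj₁ v = u G.~ v
    inj₁ _ ~ inj₂ _ = ⊥
    inj₂ _ ~ inj₁ _ = ⊥
    inj₂ u ~ inj₂ v = u H.~ v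

    ~-sym : Symmetric _~_
    ~-sym {inj₁ _} {inj₁ _} e = G.~-sym e
    ~-sym {inj₂ _} {inj₂ _} e = H.~-sym e

    ~-irrefl : ∀ {v} → ¬ (v ~ v)
    ~-irrefl {inj₁ _} e = G.~-irrefl e
    ~-irrefl {inj₂ _} e = H.~-irrefl e

    _~?_ : Decidable _~_
    inj₁ u ~? inj₁ v = u G.~? v
    inj₁ _ ~? inj₂ _ = no λ ()
    inj₂ _ ~? inj₁ _ = no λ ()
    inj₂ u ~? inj₂ v = u H.~? v

  _⊎ᴳ_ : Graph (V ⊎ W)
  _⊎ᴳ_ = record
    { _~_      = _~_
    ; ~-sym    = λ {u} {v} → ~-sym {u} {v}
    ; ~-irrefl = λ {v} → ~-irrefl {v}
    ; _~?_     = _~?_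
    ; _≟_      = Sumₚ.≡-dec G._≟_ H._≟_
    }

2K₂ : Graph (Fin 2 ⊎ Fin 2)
2K₂ = K 2 ⊎ᴳ K 2

-- attach G c r adds to G r new vertices, each adjacent to c only.

module _ {V : Set} (G : Graph V) (c : V) (r : ℕ) where
  private
    module G = Graph G

    _~_ : Rel (V ⊎ Fin r) 0ℓ
    inj₁ u ~ inj₁ v = u G.~ v
    inj₁ u ~ inj₂ _ = u ≡ c
    inj₂ _ ~ inj₁ v = v ≡ c
    inj₂ _ ~ inj₂ _ = ⊥

    ~-sym : Symmetric _~_
    ~-sym {inj₁ _} {inj₁ _} e = G.~-sym e
    ~-sym {inj₁ _} {inj₂ _} e = e
    ~-sym {inj₂ _} {inj₁ _} e = e

    ~-irrefl : ∀ {v} → ¬ (v ~ v)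
    ~-irrefl {inj₁ _} e = G.~-irrefl e

    _~?_ : Decidable _~_
    inj₁ u ~? inj₁ v = u G.~? v
    inj₁ u ~? inj₂ _ = u G.≟ c
    inj₂ _ ~? inj₁ v = v G.≟ c
    inj₂ _ ~? inj₂ _ = no λ ()

  attach : Graph (V ⊎ Fin r)
  attach = record
    { _~_      = _~_
    ; ~-sym    = λ {u} {v} → ~-sym {u} {v}
    ; ~-irrefl = λ {v} → ~-irrefl {v}
    ; _~?_     = _~?_
    ; _≟_      = Sumₚ.≡-dec G._≟_ Finₚ._≟_
    }

D : ∀ r n s → .{{NonZero n}} → Graph ((Fin n ⊎ Fin r) ⊎ Fin s)
D r (suc m) s = attach (attach (P (suc m)) Fin.zero r) (inj₁ (fromℕ m)) s

-- Token sliding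

module _ {n : ℕ} (G : Graph (Fin n)) where
  open Graph G using (_~_; ~-sym; ~-irrefl; _~?_)

  Independent : Subset n → Set
  Independent I = ∀ {u v} → u ∈ I → v ∈ I → ¬ (u ~ v)

  -- The proof component of a refinement is irrelevant, so two nodes are
  -- equal as soon as their underlying subsets are.

  IndependentSet : ℕ → Set
  IndependentSet k = [ I ∈ Subset n ∣ Independent I × ∣ I ∣ ≡ k ]

  Slide : Rel (Subset n) 0ℓ
  Slide I J = ∃[ u ] ∃[ v ] (I ─ J ≡ ⁅ u ⁆ × J ─ I ≡ ⁅ v ⁆ × u ~ v)

  private
    _≟ₛ_ : DecidableEquality (Subset n)
    _≟ₛ_ = ≡-dec Bool._≟_

    ⁅⁆-injective : ∀ {u v : Fin n} → ⁅ u ⁆ ≡ ⁅ v ⁆ → u ≡ v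
    ⁅⁆-injective {u} {v} e = x∈⁅y⁆⇒x≡y v (subst (u ∈_) e (x∈⁅x⁆ u))

    Slide-sym : Symmetric Slide
    Slide-sym (u , v , p , q , e) = v , u , q , p , ~-sym e

    Slide-irrefl : ∀ {I} → ¬ Slide I I
    Slide-irrefl (u , v , p , q , e) =
      ~-irrefl (subst (u ~_) (⁅⁆-injective (trans (sym q) p)) e)

    Slide? : Decidable Slide
    Slide? I J = Finₚ.any? λ u → Finₚ.any? λ v →
      ((I ─ J) ≟ₛ ⁅ u ⁆) ×-dec ((J ─ I) ≟ₛ ⁅ v ⁆) ×-dec (u ~? v)

  TS : ∀ k → Graph (IndependentSet k)
  TS k = record
    { _~_      = λ I J → Slide (value I) (value J)
    ; ~-sym    = Slide-sym
    ; ~-irrefl = Slide-irrefl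
    ; _~?_     = λ I J → Slide? (value I) (value J)
    ; _≟_      = Refinement._≟_ _≟ₛ_
    }

{-# OPTIONS --safe #-}
module Submission where

-- The tokens can circle around an induced 2K₂ or D₂,₂,₂, which yields a 4-cycle
-- or an 8-cycle.  Conversely, a cycle of TS₂(T) can be walked forever without
-- backtracking.  Five vertices in a path of T would induce a P₅ and hence a
-- 2K₂, so all paths are short: one token cannot make three moves in a row, and
-- a change of the moving token forces the remaining moves until the tokens have
-- visited two leaves at each end of an edge, that is, an induced D₂,₂,₂.

open import Defs
open import Data.Empty using (⊥; ⊥-elim; ⊥-elim-irr)
open import Data.Fin using (Fin; zero; suc)
open import Data.Fin.Patterns using (0F; 1F)
open import Data.Fin.Subset
  using (Subset; inside; outside; _∈_; _∉_; _⊆_; _∪_; _─_; ⁅_⁆; ∣_∣)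
  renaming (⊥ to ∅)
open import Data.Fin.Subset.Properties
  using ( _∈?_; ⊆-antisym; x∈⁅x⁆; x∈⁅y⁆⇒x≡y; ∣⁅x⁆∣≡1; ∪-comm; ∪-idem; ∪-identityˡ; ∪-identityʳ
        ; x∈p∪q⁻; x∈p∪q⁺; x∈p∧x∉q⇒x∈p─q; p─q⊆p )
open import Data.Irrelevant using ([_])
open import Data.List using (List; _∷_; []; _∷ʳ_; map; length)
open import Data.List.Properties using (map-++; length-map)
import Data.List.Membership.Propositional as List
open import Data.List.Relation.Unary.All as All using (All; []; _∷_)
open import Data.List.Relation.Unary.AllPairs as AllPairs using (AllPairs; []; _∷_; allPairs?)
import Data.List.Relation.Unary.AllPairs.Properties as AllPairsₚ
open import Data.List.Relation.Unary.Any using (here; there)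
open import Data.List.Relation.Unary.Linked as Linked using (Linked; [-]; _∷_; linked?)
import Data.List.Relation.Unary.Linked.Properties as Linkedₚ
open import Data.List.Relation.Unary.Unique.Propositional using (Unique)
open import Data.Nat using (ℕ; zero; suc; _≤_; z≤n; s≤s; s≤s⁻¹)
import Data.Nat.Properties as ℕₚ
open import Data.Product using (_×_; _,_; proj₁; proj₂; ∃-syntax; Σ-syntax)
open import Data.Refinement using (_,_; value; value-injective)
open import Data.Sum as Sum using (_⊎_; inj₁; inj₂)
open import Data.Vec using ([]; _∷_; there)
open import Function using (_∘_; case_of_)
open import Function.Bundles using (_⇔_; mk⇔; Equivalence)
open import Relation.Binary.Construct.Closure.ReflexiveTransitive using (ε; _◅_)
open import Relation.Binary.Definitions using (Decidable)
open import Relation.Binary.PropositionalEquality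
  using (_≡_; _≢_; refl; sym; trans; cong; subst; subst₂; ≢-sym)
open import Relation.Nullary using (¬_; yes; no; contradiction)
open import Relation.Nullary.Decidable
  using (True; toWitness; ¬?; _×-dec_; _⊎-dec_; decidable-stable; recompute)

private variable
  n : ℕ
  V W : Set

-- Recognising induced subgraphs pair by pair

module InducedEmbedding (H : Graph W) (G : Graph V) (f : W → V) where
  private
    module H = Graph H
    module G = Graph G

  -- Injectivity and the edge condition are bundled for a single pair. The relation is symmetric, so
  -- each unordered pair of vertices has to be checked only once.
  Compatible : W → W → Set
  Compatible u v = f u ≢ f v × ((u H.~ v) ⇔ (f u G.~ f v))

  edge : ∀ {u v} → u H.~ v → f u G.~ f v → Compatible u v
  edge u~v fu~fv =
    (λ e → G.~-irrefl (subst (G._~ f _) e fu~fv)) , mk⇔ (λ _ → fu~fv) (λ _ → u~v)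

  nonedge : ∀ {u v} → ¬ (u H.~ v) → f u ≢ f v → ¬ (f u G.~ f v) → Compatible u v
  nonedge u≁v fu≢fv fu≁fv =
    fu≢fv , mk⇔ (λ e → contradiction e u≁v) (λ e → contradiction e fu≁fv)

  Compatible-sym : ∀ {u v} → Compatible u v → Compatible v u
  Compatible-sym (fu≢fv , e) = ≢-sym fu≢fv ,
    mk⇔ (G.~-sym ∘ Equivalence.to e ∘ H.~-sym) (H.~-sym ∘ Equivalence.from e ∘ G.~-sym)

  private
    compare : ∀ {ws} → AllPairs Compatible ws → ∀ {u v} → u List.∈ ws → v List.∈ ws →
              u ≡ v ⊎ Compatible u v
    compare (_  ∷ _)  (here refl) (here refl) = inj₁ refl
    compare (cs ∷ _)  (here refl) (there v∈)  = inj₂ (All.lookup cs v∈)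
    compare (cs ∷ _)  (there u∈)  (here refl) = inj₂ (Compatible-sym (All.lookup cs u∈))
    compare (_  ∷ ps) (there u∈)  (there v∈)  = compare ps u∈ v∈

  -- Two vertices sit at the same position of the list, and are then equal, or at different ones,
  -- and are then compatible up to symmetry. On the diagonal the edge condition holds because
  -- neither graph has loops.
  induced-embedding : (ws : List W) → (∀ w → w List.∈ ws) → AllPairs Compatible ws → H ≤ᵢ G
  induced-embedding ws ∈ws ps = record
    { embed     = f
    ; injective = λ {u} {v} fu≡fv → case compare ps (∈ws u) (∈ws v) of λ where
        (inj₁ u≡v)         → u≡v
        (inj₂ (fu≢fv , _)) → contradiction fu≡fv fu≢fv
    ; induced   = λ u v → case compare ps (∈ws u) (∈ws v) of λ where
        (inj₁ refl)    → mk⇔ (⊥-elim ∘ H.~-irrefl) (⊥-elim ∘ G.~-irrefl)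
        (inj₂ (_ , e)) → e
    }

-- Short cycles and the two forbidden subgraphs

module _ (G : Graph V) where
  open Graph G

  ~⇒≢ : ∀ {a b} → a ~ b → a ≢ b
  ~⇒≢ a~b refl = ~-irrefl a~b

  ≁∧~⇒≢ : ∀ {a b c} → ¬ (a ~ c) → b ~ c → a ≢ b
  ≁∧~⇒≢ a≁c b~c refl = a≁c b~c

  -- Distinctness across the two edges follows from the non-adjacencies: `a` differs from `c`, for
  -- instance, because `d` is adjacent to `c` but not to `a`.
  induced-2K₂ : ∀ {a b c d} → a ~ b → c ~ d →
    ¬ (a ~ c) → ¬ (a ~ d) → ¬ (b ~ c) → ¬ (b ~ d) → 2K₂ ≤ᵢ G
  induced-2K₂ {a} {b} {c} {d} a~b c~d a≁c a≁d b≁c b≁d =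
    induced-embedding (inj₁ 0F ∷ inj₁ 1F ∷ inj₂ 0F ∷ inj₂ 1F ∷ []) enum
      ( ( edge (λ ()) a~b
        ∷ nonedge (λ ()) (≁∧~⇒≢ a≁d c~d) a≁c
        ∷ nonedge (λ ()) (≁∧~⇒≢ a≁c (~-sym c~d)) a≁d
        ∷ [])
      ∷ ( nonedge (λ ()) (≁∧~⇒≢ b≁d c~d) b≁c
        ∷ nonedge (λ ()) (≁∧~⇒≢ b≁c (~-sym c~d)) b≁d
        ∷ [])
      ∷ (edge (λ ()) c~d ∷ [])
      ∷ [] ∷ [])
    where
    f : Fin 2 ⊎ Fin 2 → V
    f (inj₁ 0F) = a
    f (inj₁ 1F) = b
    f (inj₂ 0F) = c
    f (inj₂ 1F) = d
    open InducedEmbedding 2K₂ G f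
    enum : ∀ w → w List.∈ (inj₁ 0F ∷ inj₁ 1F ∷ inj₂ 0F ∷ inj₂ 1F ∷ [])
    enum (inj₁ 0F) = here refl
    enum (inj₁ 1F) = there (here refl)
    enum (inj₂ 0F) = there (there (here refl))
    enum (inj₂ 1F) = there (there (there (here refl)))

  module _ (acyclic : Acyclic G) where

    no-3-cycle : ∀ {a b c} → a ~ b → b ~ c → ¬ (a ~ c)
    no-3-cycle a~b b~c a~c = acyclic record
      { v        = _
      ; vs       = _ ∷ _ ∷ []
      ; distinct = (~⇒≢ a~b ∷ ~⇒≢ a~c ∷ []) ∷ (~⇒≢ b~c ∷ []) ∷ [] ∷ []
      ; closed   = a~b ∷ b~c ∷ ~-sym a~c ∷ [-]
      ; long     = ℕₚ.≤-refl
      }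

    no-4-cycle : ∀ {a b c d} → a ~ b → b ~ c → c ~ d → a ≢ c → b ≢ d → ¬ (a ~ d)
    no-4-cycle a~b b~c c~d a≢c b≢d a~d = acyclic record
      { v        = _
      ; vs       = _ ∷ _ ∷ _ ∷ []
      ; distinct = (~⇒≢ a~b ∷ a≢c ∷ ~⇒≢ a~d ∷ []) ∷ (~⇒≢ b~c ∷ b≢d ∷ []) ∷ (~⇒≢ c~d ∷ []) ∷ [] ∷ []
      ; closed   = a~b ∷ b~c ∷ c~d ∷ ~-sym a~d ∷ [-]
      ; long     = ℕₚ.n≤1+n 3
      }

    -- If the two ends coincided, the walk would be a triangle.
    path₃⇒≢ : ∀ {a b c d} → a ~ b → b ~ c → c ~ d → a ≢ d
    path₃⇒≢ a~b b~c c~d refl = no-3-cycle a~b b~c (~-sym c~d)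

    -- Adjacent vertices differ for lack of loops and vertices three apart by `path₃⇒≢`, so it is
    -- enough to assume distinctness two apart.
    no-5-cycle : ∀ {a b c d e} → a ~ b → b ~ c → c ~ d → d ~ e →
                 a ≢ c → b ≢ d → c ≢ e → ¬ (a ~ e)
    no-5-cycle a~b b~c c~d d~e a≢c b≢d c≢e a~e = acyclic record
      { v        = _
      ; vs       = _ ∷ _ ∷ _ ∷ _ ∷ []
      ; distinct = (~⇒≢ a~b ∷ a≢c ∷ path₃⇒≢ a~b b~c c~d ∷ ~⇒≢ a~e ∷ [])
                 ∷ (~⇒≢ b~c ∷ b≢d ∷ path₃⇒≢ b~c c~d d~e ∷ [])
                 ∷ (~⇒≢ c~d ∷ c≢e ∷ []) ∷ (~⇒≢ d~e ∷ []) ∷ [] ∷ []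
      ; closed   = a~b ∷ b~c ∷ c~d ∷ d~e ∷ ~-sym a~e ∷ [-]
      ; long     = ℕₚ.m≤n+m 3 2
      }

    -- Drop the middle vertex: any edge between the two end edges would close a cycle of length 3, 4
    -- or 5.
    path₅⇒2K₂ : ∀ {a b c d e} → a ~ b → b ~ c → c ~ d → d ~ e →
                a ≢ c → b ≢ d → c ≢ e → 2K₂ ≤ᵢ G
    path₅⇒2K₂ a~b b~c c~d d~e a≢c b≢d c≢e = induced-2K₂ a~b d~e
      (no-4-cycle a~b b~c c~d a≢c b≢d) (no-5-cycle a~b b~c c~d d~e a≢c b≢d c≢e)
      (no-3-cycle b~c c~d) (no-4-cycle b~c c~d d~e b≢d c≢e)

    -- Vertices two apart are non-adjacent for lack of triangles. Leaves at opposite ends of the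
    -- edge `a b` are handled by `far`: if equal they would close a triangle, if adjacent a 4-cycle.
    induced-D₂₂₂ : ∀ {a b x x′ y y′} → a ~ b → x ~ a → x′ ~ a → b ~ y → b ~ y′ →
      x ≢ b → x′ ≢ b → a ≢ y → a ≢ y′ → x ≢ x′ → y ≢ y′ → D 2 2 2 ≤ᵢ G
    induced-D₂₂₂ {a} {b} {x} {x′} {y} {y′} a~b x~a x′~a b~y b~y′ x≢b x′≢b a≢y a≢y′ x≢x′ y≢y′ =
      induced-embedding ws enum
        ( ( edge (inj₁ refl) a~b
          ∷ edge refl (~-sym x~a)
          ∷ edge refl (~-sym x′~a)
          ∷ nonedge (λ ()) a≢y (no-3-cycle a~b b~y)
          ∷ nonedge (λ ()) a≢y′ (no-3-cycle a~b b~y′)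
          ∷ [])
        ∷ ( nonedge (λ ()) (≢-sym x≢b) (no-3-cycle (~-sym a~b) (~-sym x~a))
          ∷ nonedge (λ ()) (≢-sym x′≢b) (no-3-cycle (~-sym a~b) (~-sym x′~a))
          ∷ edge refl b~y
          ∷ edge refl b~y′
          ∷ [])
        ∷ ( nonedge (λ ()) x≢x′ (no-3-cycle x~a (~-sym x′~a))
          ∷ far x~a x≢b b~y a≢y (λ ())
          ∷ far x~a x≢b b~y′ a≢y′ (λ ())
          ∷ [])
        ∷ ( far x′~a x′≢b b~y a≢y (λ ())
          ∷ far x′~a x′≢b b~y′ a≢y′ (λ ())
          ∷ [])
        ∷ (nonedge (λ ()) y≢y′ (no-3-cycle (~-sym b~y) b~y′) ∷ [])
        ∷ [] ∷ [])
      where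
      f : (Fin 2 ⊎ Fin 2) ⊎ Fin 2 → V
      f (inj₁ (inj₁ 0F)) = a
      f (inj₁ (inj₁ 1F)) = b
      f (inj₁ (inj₂ 0F)) = x
      f (inj₁ (inj₂ 1F)) = x′
      f (inj₂ 0F)        = y
      f (inj₂ 1F)        = y′
      open InducedEmbedding (D 2 2 2) G f
      ws : List ((Fin 2 ⊎ Fin 2) ⊎ Fin 2)
      ws = inj₁ (inj₁ 0F) ∷ inj₁ (inj₁ 1F) ∷ inj₁ (inj₂ 0F) ∷ inj₁ (inj₂ 1F)
         ∷ inj₂ 0F ∷ inj₂ 1F ∷ []
      enum : ∀ w → w List.∈ ws
      enum (inj₁ (inj₁ 0F)) = here refl
      enum (inj₁ (inj₁ 1F)) = there (here refl)
      enum (inj₁ (inj₂ 0F)) = there (there (here refl))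
      enum (inj₁ (inj₂ 1F)) = there (there (there (here refl)))
      enum (inj₂ 0F)        = there (there (there (there (here refl))))
      enum (inj₂ 1F)        = there (there (there (there (there (here refl)))))
      far : ∀ {u v} → f u ~ a → f u ≢ b → b ~ f v → a ≢ f v → ¬ (Graph._~_ (D 2 2 2) u v) →
            Compatible u v
      far fu~a fu≢b b~fv a≢fv u≁v = nonedge u≁v
        (path₃⇒≢ fu~a a~b b~fv) (no-4-cycle fu~a a~b b~fv fu≢b a≢fv)

-- Neighbours along a cycle

-- Either the predecessor or the successor on the cycle differs from y.
module _ {G : Graph V} (C : Cycle G) where
  open Graph G
  open Cycle C

  private
    pick : ∀ {x z₁ z₂} {P : V → Set} → P z₁ → P z₂ → x ~ z₁ → x ~ z₂ → z₁ ≢ z₂ → ∀ y →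
           ∃[ z ] P z × x ~ z × z ≢ y
    pick {z₁ = z₁} p₁ p₂ e₁ e₂ z₁≢z₂ y with z₁ ≟ y
    ... | no  z₁≢y = _ , p₁ , e₁ , z₁≢y
    ... | yes refl = _ , p₂ , e₂ , ≢-sym z₁≢z₂

    last-neighbour : ∀ {q} y ys → Linked _~_ ((y ∷ ys) ∷ʳ q) → ∃[ z ] z List.∈ (y ∷ ys) × q ~ z
    last-neighbour y []        (y~q ∷ [-]) = y , here refl , ~-sym y~q
    last-neighbour y (y′ ∷ ys) (_ ∷ l)     with last-neighbour y′ ys l
    ... | z , z∈ , q~z = z , there z∈ , q~z

    -- In the induction `p` advances while `q` stays fixed. The disjunction serves a single
    -- remaining interior vertex, whose neighbours are `p` and `q`: at the start `p` may equal `q`,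
    -- but then `xs` is longer; afterwards `p` comes from the original `xs`, which does not contain
    -- `q`.
    interior : ∀ {p q} xs → Linked _~_ ((p ∷ xs) ∷ʳ q) → Unique (p ∷ xs) → q List.∉ xs →
               p ≢ q ⊎ 2 ≤ length xs → ∀ {x} → x List.∈ xs → ∀ y →
               ∃[ z ] z List.∈ (q ∷ p ∷ xs) × x ~ z × z ≢ y
    interior (x ∷ []) (p~x ∷ x~q ∷ [-]) _ _ (inj₁ p≢q) (here refl) =
      pick (there (here refl)) (here refl) (~-sym p~x) x~q p≢q
    interior (x ∷ []) _ _ _ (inj₂ (s≤s ())) (here refl)
    interior (x ∷ x′ ∷ xs) (p~x ∷ x~x′ ∷ _) ((_ ∷ p≢x′ ∷ _) ∷ _) _ _ (here refl) =
      pick (there (here refl)) (there (there (there (here refl)))) (~-sym p~x) x~x′ p≢x′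
    interior (x ∷ xs) (_ ∷ l) (_ ∷ u) q∉ _ (there x∈) y
      with interior xs l u (q∉ ∘ there) (inj₁ λ { refl → q∉ (here refl) }) x∈ y
    ... | z , here z≡q , e , z≢y = z , here z≡q , e , z≢y
    ... | z , there z∈ , e , z≢y = z , there (there z∈) , e , z≢y

  nodes : List V
  nodes = v ∷ vs

  another-neighbour : ∀ {x} → x List.∈ nodes → ∀ y → ∃[ z ] z List.∈ nodes × x ~ z × z ≢ y
  another-neighbour x∈ y = go vs closed distinct (s≤s⁻¹ long) x∈
    where
    go : ∀ vs → Linked _~_ ((v ∷ vs) ∷ʳ v) → Unique (v ∷ vs) → 2 ≤ length vs →
         ∀ {x} → x List.∈ (v ∷ vs) → ∃[ z ] z List.∈ (v ∷ vs) × x ~ z × z ≢ y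
    go (a ∷ []) _ _ (s≤s ()) (here refl)
    -- The base vertex has the first and the last entry of the list as neighbours; they differ
    -- because `a` does not recur.
    go (a ∷ b ∷ vs) (v~a ∷ _ ∷ l) (_ ∷ a∉ ∷ _) _ (here refl)
      with last-neighbour b vs l
    ... | z , z∈ , v~z =
      pick (there (here refl)) (there (there z∈)) v~a v~z (All.lookup a∉ z∈) y
    go vs l u@(v∉ ∷ _) 2≤ (there x∈)
      with interior vs l u (λ v∈ → All.lookup v∉ v∈ refl) (inj₂ 2≤) x∈ y
    ... | z , here z≡v , e , z≢y = z , here z≡v , e , z≢y
    ... | z , there z∈ , e , z≢y = z , z∈ , e , z≢y

-- Subsets with two elements

x∈p─q⇒x∉q : ∀ {x} (p q : Subset n) → x ∈ p ─ q → x ∉ q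
x∈p─q⇒x∉q (inside  ∷ p) (inside  ∷ q) (there x∈) (there x∈q) = x∈p─q⇒x∉q p q x∈ x∈q
x∈p─q⇒x∉q (inside  ∷ p) (outside ∷ q) (there x∈) (there x∈q) = x∈p─q⇒x∉q p q x∈ x∈q
x∈p─q⇒x∉q (outside ∷ p) (inside  ∷ q) (there x∈) (there x∈q) = x∈p─q⇒x∉q p q x∈ x∈q
x∈p─q⇒x∉q (outside ∷ p) (outside ∷ q) (there x∈) (there x∈q) = x∈p─q⇒x∉q p q x∈ x∈q

pair : Fin n → Fin n → Subset n
pair a b = ⁅ a ⁆ ∪ ⁅ b ⁆

pair-comm : (a b : Fin n) → pair a b ≡ pair b a
pair-comm a b = ∪-comm ⁅ a ⁆ ⁅ b ⁆

∈-pair⁻ : ∀ {x} (a b : Fin n) → x ∈ pair a b → x ≡ a ⊎ x ≡ b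
∈-pair⁻ a b x∈ with x∈p∪q⁻ ⁅ a ⁆ ⁅ b ⁆ x∈
... | inj₁ x∈a = inj₁ (x∈⁅y⁆⇒x≡y a x∈a)
... | inj₂ x∈b = inj₂ (x∈⁅y⁆⇒x≡y b x∈b)

∈-pairˡ : (a b : Fin n) → a ∈ pair a b
∈-pairˡ a b = x∈p∪q⁺ (inj₁ (x∈⁅x⁆ a))

∈-pairʳ : (a b : Fin n) → b ∈ pair a b
∈-pairʳ a b = x∈p∪q⁺ (inj₂ (x∈⁅x⁆ b))

pair-⊆ : ∀ {a b : Fin n} {p} → a ∈ p → b ∈ p → pair a b ⊆ p
pair-⊆ {a = a} {b} a∈p b∈p x∈ with ∈-pair⁻ a b x∈
... | inj₁ refl = a∈p
... | inj₂ refl = b∈p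

∉-pair : ∀ {x a b : Fin n} → x ≢ a → x ≢ b → x ∉ pair a b
∉-pair x≢a x≢b x∈ = Sum.[ x≢a , x≢b ] (∈-pair⁻ _ _ x∈)

pair-injective : ∀ {a b c d : Fin n} → pair a b ≡ pair c d → (a ≡ c × b ≡ d) ⊎ (a ≡ d × b ≡ c)
pair-injective {a = a} {b} {c} {d} e
  with ∈-pair⁻ c d (subst (a ∈_) e (∈-pairˡ a b)) | ∈-pair⁻ c d (subst (b ∈_) e (∈-pairʳ a b))
... | inj₁ refl | inj₂ refl = inj₁ (refl , refl)
... | inj₂ refl | inj₁ refl = inj₂ (refl , refl)
-- Here `a` and `b` coincide, so the pair is a singleton and `d` must coincide with them too.
... | inj₁ refl | inj₁ refl with ∈-pair⁻ a a (subst (d ∈_) (sym e) (∈-pairʳ a d))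
...   | inj₁ refl = inj₁ (refl , refl)
...   | inj₂ refl = inj₁ (refl , refl)
pair-injective {a = a} {b} {c} {d} e | inj₂ refl | inj₂ refl
  with ∈-pair⁻ a a (subst (c ∈_) (sym e) (∈-pairˡ c a))
... | inj₁ refl = inj₁ (refl , refl)
... | inj₂ refl = inj₁ (refl , refl)

∣pair∣≡2 : {a b : Fin n} → a ≢ b → ∣ pair a b ∣ ≡ 2
∣pair∣≡2 {a = zero}  {zero}  a≢b = contradiction refl a≢b
∣pair∣≡2 {a = zero}  {suc b} a≢b = cong suc (trans (cong ∣_∣ (∪-identityˡ ⁅ b ⁆)) (∣⁅x⁆∣≡1 b))
∣pair∣≡2 {a = suc a} {zero}  a≢b = cong suc (trans (cong ∣_∣ (∪-identityʳ ⁅ a ⁆)) (∣⁅x⁆∣≡1 a))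
∣pair∣≡2 {a = suc a} {suc b} a≢b = ∣pair∣≡2 (a≢b ∘ cong suc)

∣pair∣≡2⇒≢ : {a b : Fin n} → ∣ pair a b ∣ ≡ 2 → a ≢ b
∣pair∣≡2⇒≢ {a = a} ∣p∣≡2 refl
  with () ← trans (sym ∣p∣≡2) (trans (cong ∣_∣ (∪-idem ⁅ a ⁆)) (∣⁅x⁆∣≡1 a))

∣p∣≡0⇒p≡∅ : (p : Subset n) → ∣ p ∣ ≡ 0 → p ≡ ∅
∣p∣≡0⇒p≡∅ []            _ = refl
∣p∣≡0⇒p≡∅ (outside ∷ p) e = cong (outside ∷_) (∣p∣≡0⇒p≡∅ p e)

∣p∣≡1⇒singleton : (p : Subset n) → ∣ p ∣ ≡ 1 → ∃[ a ] p ≡ ⁅ a ⁆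
∣p∣≡1⇒singleton (inside  ∷ p) e = zero , cong (inside ∷_) (∣p∣≡0⇒p≡∅ p (ℕₚ.suc-injective e))
∣p∣≡1⇒singleton (outside ∷ p) e with ∣p∣≡1⇒singleton p e
... | a , p≡ = suc a , cong (outside ∷_) p≡

∣p∣≡2⇒pair : (p : Subset n) → ∣ p ∣ ≡ 2 → ∃[ a ] ∃[ b ] p ≡ pair a b
∣p∣≡2⇒pair (inside  ∷ p) e with ∣p∣≡1⇒singleton p (ℕₚ.suc-injective e)
... | a , p≡ = zero , suc a , cong (inside ∷_) (trans p≡ (sym (∪-identityˡ ⁅ a ⁆)))
∣p∣≡2⇒pair (outside ∷ p) e with ∣p∣≡2⇒pair p e
... | a , b , p≡ = suc a , suc b , cong (outside ∷_) p≡

pair─pair : ∀ {a b c : Fin n} → a ≢ b → a ≢ c → pair a c ─ pair b c ≡ ⁅ a ⁆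
pair─pair {a = a} {b} {c} a≢b a≢c = ⊆-antisym ⊆₁ ⊆₂
  where
  ⊆₁ : pair a c ─ pair b c ⊆ ⁅ a ⁆
  ⊆₁ x∈ with ∈-pair⁻ a c (p─q⊆p (pair a c) (pair b c) x∈)
  ... | inj₁ refl = x∈⁅x⁆ a
  ... | inj₂ refl = contradiction (∈-pairʳ b c) (x∈p─q⇒x∉q (pair a c) (pair b c) x∈)
  ⊆₂ : ⁅ a ⁆ ⊆ pair a c ─ pair b c
  ⊆₂ x∈ with refl ← x∈⁅y⁆⇒x≡y a x∈ = x∈p∧x∉q⇒x∈p─q (∈-pairˡ a c) (∉-pair a≢b a≢c)

-- Since only `a` leaves, `b` stays; since only `v` arrives, every other member of `J` is an old
-- one, hence `b`.
exchange : ∀ {a b v : Fin n} {J} → a ≢ b →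
           pair a b ─ J ≡ ⁅ a ⁆ → J ─ pair a b ≡ ⁅ v ⁆ → J ≡ pair v b
exchange {a = a} {b} {v} {J} a≢b I─J J─I = ⊆-antisym J⊆ (pair-⊆ v∈J b∈J)
  where
  v∈J : v ∈ J
  v∈J = p─q⊆p J (pair a b) (subst (v ∈_) (sym J─I) (x∈⁅x⁆ v))
  b∈J : b ∈ J
  b∈J = decidable-stable (b ∈? J) λ b∉J →
    a≢b (sym (x∈⁅y⁆⇒x≡y a (subst (b ∈_) I─J (x∈p∧x∉q⇒x∈p─q (∈-pairʳ a b) b∉J))))
  a∉J : a ∉ J
  a∉J = x∈p─q⇒x∉q (pair a b) J (subst (a ∈_) (sym I─J) (x∈⁅x⁆ a))
  J⊆ : J ⊆ pair v b
  J⊆ {x} x∈J with x ∈? pair a b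
  ... | no x∉I = x∈p∪q⁺ (inj₁ (subst (x ∈_) J─I (x∈p∧x∉q⇒x∈p─q x∈J x∉I)))
  ... | yes x∈I with ∈-pair⁻ a b x∈I
  ...   | inj₁ refl = contradiction x∈J a∉J
  ...   | inj₂ refl = ∈-pairʳ v b

-- Token slides on pairs

module _ (G : Graph (Fin n)) where
  open Graph G

  slide : ∀ {a b c} → a ≢ c → b ≢ c → a ~ b → Slide G (pair a c) (pair b c)
  slide a≢c b≢c a~b =
    _ , _ , pair─pair (~⇒≢ G a~b) a≢c , pair─pair (≢-sym (~⇒≢ G a~b)) b≢c , a~b

  slide⁻ : ∀ {a b J} → a ≢ b → Slide G (pair a b) J →
           (∃[ c ] a ~ c × J ≡ pair c b) ⊎ (∃[ c ] b ~ c × J ≡ pair a c)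
  slide⁻ {a} {b} {J} a≢b (u , v , I─J , J─I , u~v)
    with ∈-pair⁻ a b (p─q⊆p (pair a b) J (subst (u ∈_) (sym I─J) (x∈⁅x⁆ u)))
  ... | inj₁ refl = inj₁ (v , u~v , exchange a≢b I─J J─I)
  ... | inj₂ refl = inj₂ (v , u~v , trans (exchange (≢-sym a≢b)
    (subst (λ I → I ─ J ≡ ⁅ u ⁆) (pair-comm a b) I─J)
    (subst (λ I → J ─ I ≡ ⁅ v ⁆) (pair-comm a b) J─I)) (pair-comm v a))

  -- The proof stored in a node is irrelevant. Its size part can still be used because equality of
  -- natural numbers is decidable; its independence part, in `independent`, because the goal there
  -- is a contradiction.
  size : ∀ {k} (I : IndependentSet G k) → ∣ value I ∣ ≡ k
  size (_ , [ p ]) = recompute (_ ℕₚ.≟ _) (proj₂ p)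

  independent : ∀ {k} (I : IndependentSet G k) → Independent G (value I)
  independent (_ , [ p ]) u∈I v∈I u~v = ⊥-elim-irr (proj₁ p u∈I v∈I u~v)

-- Transporting token walks along an induced embedding

-- Ordered placements of two tokens on H, so that a cycle of TS₂(H) can be
-- given by computation and then carried along an embedding.
module _ (H : Graph W) where
  open Graph H

  -- Validity is `True` of a decision, so that for concrete vertices it reduces to the unit type and
  -- can be filled in by `_`.
  Placement : Set
  Placement = Σ[ (x , y) ∈ W × W ] True (¬? (x ≟ y) ×-dec ¬? (x ~? y))

  Step : Placement → Placement → Set
  Step ((x , y) , _) ((x′ , y′) , _) = (x ~ x′ × y ≡ y′) ⊎ (x ≡ x′ × y ~ y′)

  Step? : Decidable Step
  Step? ((x , y) , _) ((x′ , y′) , _) =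
    ((x ~? x′) ×-dec (y ≟ y′)) ⊎-dec ((x ≟ x′) ×-dec (y ~? y′))

  -- Tokens are indistinguishable: a placement and its swap give the same node, so both must be
  -- excluded.
  Apart : Placement → Placement → Set
  Apart ((x , y) , _) ((x′ , y′) , _) = ¬ ((x ≡ x′ × y ≡ y′) ⊎ (x ≡ y′ × y ≡ x′))

  Apart? : Decidable Apart
  Apart? ((x , y) , _) ((x′ , y′) , _) =
    ¬? (((x ≟ x′) ×-dec (y ≟ y′)) ⊎-dec ((x ≟ y′) ×-dec (y ≟ x′)))

module _ {H : Graph W} {G : Graph (Fin n)} (H≤G : H ≤ᵢ G) where
  private
    module H = Graph H
    module G = Graph G
  open _≤ᵢ_ H≤G

  place : Placement H → IndependentSet G 2
  place ((x , y) , valid) = pair (embed x) (embed y) ,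
    [ (λ {u} {v} → indep {u} {v}) , ∣pair∣≡2 (x≢y ∘ injective) ]
    where
    x≢y : x ≢ y
    x≢y = proj₁ (toWitness valid)
    x≁y : ¬ (embed x G.~ embed y)
    x≁y = proj₂ (toWitness valid) ∘ Equivalence.from (induced x y)
    indep : Independent G (pair (embed x) (embed y))
    indep u∈ v∈ u~v with ∈-pair⁻ (embed x) (embed y) u∈ | ∈-pair⁻ (embed x) (embed y) v∈
    ... | inj₁ refl | inj₁ refl = G.~-irrefl u~v
    ... | inj₁ refl | inj₂ refl = x≁y u~v
    ... | inj₂ refl | inj₁ refl = x≁y (G.~-sym u~v)
    ... | inj₂ refl | inj₂ refl = G.~-irrefl u~v

  place-step : ∀ {p q} → Step H p q → Graph._~_ (TS G 2) (place p) (place q)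
  place-step {(x , y) , p} {(x′ , _) , q} (inj₁ (x~x′ , refl)) =
    slide G (proj₁ (toWitness p) ∘ injective) (proj₁ (toWitness q) ∘ injective)
      (Equivalence.to (induced x x′) x~x′)
  place-step {(x , y) , p} {(_ , y′) , q} (inj₂ (refl , y~y′)) =
    subst₂ (Slide G) (pair-comm (embed y) (embed x)) (pair-comm (embed y′) (embed x))
      (slide G (≢-sym (proj₁ (toWitness p) ∘ injective)) (≢-sym (proj₁ (toWitness q) ∘ injective))
        (Equivalence.to (induced y y′) y~y′))

  place-apart : ∀ {p q} → Apart H p q → place p ≢ place q
  place-apart apart e with pair-injective (cong value e)
  ... | inj₁ (x≡ , y≡) = apart (inj₁ (injective x≡ , injective y≡))
  ... | inj₂ (x≡ , y≡) = apart (inj₂ (injective x≡ , injective y≡))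

  TS₂-cycle : ∀ p ps → True (allPairs? (Apart? H) (p ∷ ps)) →
              True (linked? (Step? H) ((p ∷ ps) ∷ʳ p)) → 3 ≤ length (p ∷ ps) → Cycle (TS G 2)
  TS₂-cycle p ps apart steps 3≤ = record
    { v        = place p
    ; vs       = map place ps
    ; distinct = AllPairsₚ.map⁺ (AllPairs.map (λ {p} {q} → place-apart {p} {q}) (toWitness apart))
    ; closed   = subst (Linked _) (map-++ place (p ∷ ps) (p ∷ []))
                   (Linkedₚ.map⁺ (Linked.map (λ {p} {q} → place-step {p} {q}) (toWitness steps)))
    ; long     = subst (3 ≤_) (sym (length-map place (p ∷ ps))) 3≤
    }

-- Each token stays on its own edge, and the two take turns to cross it.
2K₂⇒TS₂-cycle : {G : Graph (Fin n)} → 2K₂ ≤ᵢ G → Cycle (TS G 2)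
2K₂⇒TS₂-cycle 2K₂≤G = TS₂-cycle 2K₂≤G
  ((a , c) , _) (((b , c) , _) ∷ ((b , d) , _) ∷ ((a , d) , _) ∷ []) _ _ (s≤s (s≤s (s≤s z≤n)))
  where
  a b c d : Fin 2 ⊎ Fin 2
  a = inj₁ 0F
  b = inj₁ 1F
  c = inj₂ 0F
  d = inj₂ 1F

-- The tokens take turns to pass between the two leaves at their own end, each through its centre. A
-- centre is entered only while the other token rests on a leaf.
D₂₂₂⇒TS₂-cycle : {G : Graph (Fin n)} → D 2 2 2 ≤ᵢ G → Cycle (TS G 2)
D₂₂₂⇒TS₂-cycle D≤G = TS₂-cycle D≤G
  ((x , y) , _)
  ( ((a , y) , _) ∷ ((x′ , y) , _) ∷ ((x′ , b) , _) ∷ ((x′ , y′) , _)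
  ∷ ((a , y′) , _) ∷ ((x , y′) , _) ∷ ((x , b) , _) ∷ [])
  _ _ (s≤s (s≤s (s≤s z≤n)))
  where
  a b x x′ y y′ : (Fin 2 ⊎ Fin 2) ⊎ Fin 2
  a  = inj₁ (inj₁ 0F)
  b  = inj₁ (inj₁ 1F)
  x  = inj₁ (inj₂ 0F)
  x′ = inj₁ (inj₂ 1F)
  y  = inj₂ 0F
  y′ = inj₂ 1F

-- Excluding cycles of `TS T 2` by the forbidden subgraphs

module _ {T : Graph (Fin n)} (tree : IsTree T)
         (no-2K₂ : ¬ (2K₂ ≤ᵢ T)) (no-D₂₂₂ : ¬ (D 2 2 2 ≤ᵢ T)) (C : Cycle (TS T 2)) where
  open Graph T
  open IsTree tree

  On : Fin n → Fin n → Set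
  On a b = ∃[ I ] I List.∈ nodes C × value I ≡ pair a b

  On-sym : ∀ {a b} → On a b → On b a
  On-sym {a} {b} (I , I∈ , e) = I , I∈ , trans e (pair-comm a b)

  On⇒≢ : ∀ {a b} → On a b → a ≢ b
  On⇒≢ (I , _ , refl) = ∣pair∣≡2⇒≢ (size T I)

  On⇒≁ : ∀ {a b} → On a b → ¬ (a ~ b)
  On⇒≁ {a} {b} (I , _ , refl) = independent T I (∈-pairˡ a b) (∈-pairʳ a b)

  private
    -- `J` is the node to avoid. Nodes with equal subsets are equal, so avoiding the node amounts to
    -- avoiding its subset.
    continue : ∀ {a b} J → On a b →
               (∃[ c ] a ~ c × pair c b ≢ value J × On c b) ⊎
               (∃[ c ] b ~ c × pair a c ≢ value J × On a c)
    continue {a} {b} J on@(I , I∈ , refl) with another-neighbour C I∈ J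
    ... | K , K∈ , I~K , K≢J with slide⁻ T (On⇒≢ on) I~K
    ...   | inj₁ (c , a~c , K≡) =
      inj₁ (c , a~c , (λ e → K≢J (value-injective (trans K≡ e))) , K , K∈ , K≡)
    ...   | inj₂ (c , b~c , K≡) =
      inj₂ (c , b~c , (λ e → K≢J (value-injective (trans K≡ e))) , K , K∈ , K≡)

  start : ∃[ a ] ∃[ c ] ∃[ b ] On a b × a ~ c × On c b
  start with ∣p∣≡2⇒pair (value (Cycle.v C)) (size T (Cycle.v C))
  -- No node has been left yet, so the current one serves as the node to avoid; being no neighbour
  -- of itself, it excludes no move.
  ... | a , b , I≡ with continue (Cycle.v C) (Cycle.v C , here refl , I≡)
  ...   | inj₁ (c , a~c , _ , cb) = a , c , b , (_ , here refl , I≡) , a~c , cb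
  ...   | inj₂ (c , b~c , _ , ac) = b , c , a , On-sym (_ , here refl , I≡) , b~c , On-sym ac

  -- The tokens are on a and b, and the one on a has just come from p.
  move : ∀ {p a b} → On p b → On a b →
         (∃[ c ] a ~ c × p ≢ c × On c b) ⊎ (∃[ c ] b ~ c × On a c)
  move (J , _ , J≡) on with continue J on
  ... | inj₁ (c , a~c , ≢J , on′) = inj₁ (c , a~c , (λ { refl → ≢J (sym J≡) }) , on′)
  ... | inj₂ (c , b~c , _  , on′) = inj₂ (c , b~c , on′)

  no-path₅ : ∀ {a b c d e} → a ~ b → b ~ c → c ~ d → d ~ e → a ≢ c → b ≢ d → c ≢ e → ⊥
  no-path₅ a~b b~c c~d d~e a≢c b≢d c≢e =
    no-2K₂ (path₅⇒2K₂ T acyclic a~b b~c c~d d~e a≢c b≢d c≢e)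

  -- Two edges with no link between them would induce a `2K₂`; with three of the four links missing,
  -- the fourth must be present.
  meet : ∀ {a b c d} → a ~ b → c ~ d → ¬ (a ~ c) → ¬ (a ~ d) → ¬ (b ~ c) → b ~ d
  meet {b = b} {d = d} a~b c~d a≁c a≁d b≁c =
    decidable-stable (b ~? d) λ b≁d → no-2K₂ (induced-2K₂ T a~b c~d a≁c a≁d b≁c b≁d)

  -- Changing the moving token forces the walk
  -- {u,w} → {v,w} → {v,x} → {v,x′} → {u,x′} → {u′,x′}
  -- around the centres u and x of a double star.
  no-turn : ∀ {u v w x} → On u w → u ~ v → On v w → w ~ x → On v x → ⊥
  no-turn {u} {v} {w} {x} uw u~v vw w~x vx = first (move (On-sym vw) (On-sym vx))
    where
    -- Independence of {v,w}, {v,x} and {u,w} leaves this as the only possible link between the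
    -- edges `u v` and `w x`. It is the central edge of the double star.
    u~x : u ~ x
    u~x = meet (~-sym u~v) w~x (On⇒≁ vw) (On⇒≁ vx) (On⇒≁ uw)

    v≢x : v ≢ x
    v≢x = On⇒≢ vx

    u≢w : u ≢ w
    u≢w = On⇒≢ uw

    module _ {x′} (x~x′ : x ~ x′) (w≢x′ : w ≢ x′) (x′v : On x′ v) where
      u≢x′ : u ≢ x′
      u≢x′ = ≁∧~⇒≢ T (On⇒≁ x′v) u~v ∘ sym

      -- A move beyond `x′` would extend `v u x x′` to a path on five vertices.
      stuck : ∀ {x″} → x′ ~ x″ → x ≢ x″ → ⊥
      stuck x′~x″ x≢x″ = no-path₅ (~-sym u~v) u~x x~x′ x′~x″ v≢x u≢x′ x≢x″

      third : (∃[ u′ ] u ~ u′ × v ≢ u′ × On u′ x′) ⊎ (∃[ x″ ] x′ ~ x″ × On u x″) → ⊥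
      -- `x″` is not `x`, since {u,x″} is independent while `u ~ x`.
      third (inj₂ (x″ , x′~x″ , ux″)) = stuck x′~x″ λ { refl → On⇒≁ ux″ u~x }
      -- The leaves are `v` and `u′` at `u`, and `w` and `x′` at `x`.
      third (inj₁ (u′ , u~u′ , v≢u′ , u′x′)) = no-D₂₂₂ (induced-D₂₂₂ T acyclic
        u~x (~-sym u~v) (~-sym u~u′) (~-sym w~x) x~x′
        v≢x (≁∧~⇒≢ T (On⇒≁ u′x′) x~x′) u≢w u≢x′ v≢u′ w≢x′)

      second : (∃[ x″ ] x′ ~ x″ × x ≢ x″ × On x″ v) ⊎ (∃[ v′ ] v ~ v′ × On x′ v′) → ⊥
      second (inj₁ (_ , x′~x″ , x≢x″ , _)) = stuck x′~x″ x≢x″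
      second (inj₂ (v′ , v~v′ , x′v′)) with u ≟ v′
      -- Unless the token returns to `u`, there is the path `x′ x u v v′`.
      ... | no u≢v′  = no-path₅ (~-sym x~x′) (~-sym u~x) u~v v~v′ (≢-sym u≢x′) (≢-sym v≢x) u≢v′
      ... | yes refl = third (move (On-sym x′v) (On-sym x′v′))

    first : (∃[ x′ ] x ~ x′ × w ≢ x′ × On x′ v) ⊎ (∃[ v′ ] v ~ v′ × On x v′) → ⊥
    first (inj₁ (_ , x~x′ , w≢x′ , x′v)) = second x~x′ w≢x′ x′v (move (On-sym vx) x′v)
    -- If the other token moves instead, `w x u v v′` is a path: `v′` differs from `u` because
    -- {x,v′} is independent.
    first (inj₂ (v′ , v~v′ , xv′)) =
      no-path₅ w~x (~-sym u~x) u~v v~v′ (≢-sym u≢w) (≢-sym v≢x)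
        λ { refl → On⇒≁ xv′ (~-sym u~x) }

  -- A neighbour z of the resting token's vertex w must be adjacent to u or v, and
  -- then w z u v v₂ or w z v v₂ v₃ is an induced path.
  no-long-run : ∀ {u v v₂ v₃ w} → On u w → u ~ v → On v w → v ~ v₂ → u ≢ v₂ → On v₂ w →
                v₂ ~ v₃ → v ≢ v₃ → On v₃ w → ⊥
  no-long-run {u} {v} {v₂} {v₃} {w} uw u~v vw v~v₂ u≢v₂ v₂w v₂~v₃ v≢v₃ v₃w
    -- The walk from `w` to `u` is nonempty because the tokens are on different vertices; its first
    -- edge supplies the neighbour `z`.
    with connected w u
  ... | ε = On⇒≢ uw refl
  ... | _◅_ {j = z} w~z _ with u ~? z
  ...   | yes u~z = no-path₅ w~z (~-sym u~z) u~v v~v₂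
    (≢-sym (On⇒≢ uw)) (≁∧~⇒≢ T (On⇒≁ vw) (~-sym w~z) ∘ sym) u≢v₂
  ...   | no u≁z = no-path₅ w~z (~-sym v~z) v~v₂ v₂~v₃
    (≢-sym (On⇒≢ vw)) (≁∧~⇒≢ T (On⇒≁ v₂w) (~-sym w~z) ∘ sym) v≢v₃
    where
    v~z : v ~ z
    v~z = meet u~v w~z (On⇒≁ uw) u≁z (On⇒≁ vw)

  -- Three consecutive moves suffice: either the moving token changes at the second or third, or one
  -- token makes all three.
  no-TS₂-cycle : ⊥
  no-TS₂-cycle with start
  ... | u , v , w , uw , u~v , vw with move uw vw
  ...   | inj₂ (x , w~x , vx) = no-turn uw u~v vw w~x vx
  ...   | inj₁ (v₂ , v~v₂ , u≢v₂ , v₂w) with move vw v₂w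
  ...     | inj₂ (x , w~x , v₂x) = no-turn vw v~v₂ v₂w w~x v₂x
  ...     | inj₁ (v₃ , v₂~v₃ , v≢v₃ , v₃w) =
    no-long-run uw u~v vw v~v₂ u≢v₂ v₂w v₂~v₃ v≢v₃ v₃w

proposition2 : ∀ {n : ℕ} (T : Graph (Fin n)) → IsTree T →
    Acyclic (TS T 2) ⇔ Free ((_ , 2K₂) ∷ (_ , D 2 2 2) ∷ []) T
proposition2 T tree = mk⇔
  (λ acyclic → (acyclic ∘ 2K₂⇒TS₂-cycle) ∷ (acyclic ∘ D₂₂₂⇒TS₂-cycle) ∷ [])
  (λ { (no-2K₂ ∷ no-D₂₂₂ ∷ []) → no-TS₂-cycle tree no-2K₂ no-D₂₂₂ })
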